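{- Let $r\geq 2$ be an integer and let $x_i$ ($1\le i\le r$) and $y_{i,j}$ ($2\le i\le j\le r$) be formal variables. Let $\mathcal{U}_r$ be the set of unordered increasing trees with vertex-set $\{1,\dots,r\}$. For $T\in\mathcal{U}_r$ define \[ \mathrm{wt}_y(T)=\prod_{v=2}^r\Big(x_{f_T(v)}\sum_{u\in \mathfrak{h}_T(v)} y_{v,u}\Big). \] Then \[ \sum_{T\in\mathcal{U}_r}\mathrm{wt}_y(T)= x_1\,y_{r,r}\prod_{i=2}^{r-1}\Bigg(\sum_{j=1}^{i} x_j\,y_{i,i}+\sum_{j=i+1}^{r} x_i\,y_{i,j}\Bigg). \]
   Context: A rooted tree has its edges oriented towards the root; the head of an edge is the father of its tail (the son). For a non-root vertex $v$ of a rooted tree $T$, $f_T(v)$ denotes its father. Descendants of a vertex are its sons and, recursively, descendants of its sons. An unordered increasing tree with vertex-set $\{1,\dots,r\}$ is a rooted tree on these labelled vertices (sons of a vertex are not ordered) such that the label of each son is larger than the label of its father (so the root is $1$). The hook $\mathfrak{h}_T(v)$ is the set consisting of $v$ and all its descendants in $T$. -}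

module Defs where

open import Algebra.Bundles using (CommutativeRing)
open import Data.Empty using (⊥-elim)
open import Data.Fin as Fin using (Fin; zero; suc; toℕ)
import Data.Fin.Properties as Fin
open import Data.List using (List; []; _∷_; map; foldr; filter; upTo; allFin; cartesianProductWith)
open import Data.List.Membership.Propositional using (_∈_)
import Data.List.Membership.Propositional.Properties as ∈
open import Data.List.Relation.Unary.Any using (here; there)
import Data.List.Relation.Unary.All as All
import Data.List.Relation.Unary.All.Properties as All
open import Data.List.Relation.Unary.AllPairs using ([]; _∷_)
open import Data.List.Relation.Unary.Unique.Propositional using (Unique)
import Data.List.Relation.Unary.Unique.Propositional.Properties as Unique
open import Data.Maybe using (Maybe; just; nothing; maybe′)
import Data.Maybe.Properties as Maybe
open import Data.Nat as ℕ using (ℕ; zero; suc; _≤_; _<_; _≤?_; _∸_; s≤s)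
import Data.Nat.Properties as ℕ
open import Data.Product using (∃; _×_; _,_; proj₂)
open import Data.Sum using (_⊎_; inj₁; inj₂)
open import Data.Vec as Vec using (Vec; lookup)
import Data.Vec.Properties as Vec
open import Function using (_∘_)
open import Function.Bundles using (_⇔_; mk⇔)
open import Relation.Binary.Construct.Closure.Transitive using (TransClosure; [_]; _∷_)
open import Relation.Binary.PropositionalEquality using (_≡_; _≢_; refl; sym; trans; subst)
open import Relation.Nullary using (¬_; Dec; yes; no)
open import Relation.Nullary.Decidable using (map′; _×-dec_; _⊎-dec_; _→-dec_; ¬?)

-- The integers a, a + 1, …, b (none if b < a).
range : ℕ → ℕ → List ℕ
range a b = map (a ℕ.+_) (upTo (suc b ∸ a))

-- The vertex i : Fin r carries the label toℕ i + 1, so that labels run over 1, …, r.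
label : ∀ {r} → Fin r → ℕ
label v = suc (toℕ v)

-- A set of edges on {1, …, r} oriented from sons to fathers, with at most one
-- edge leaving each vertex: entry v is the father of v, or nothing.
-- Sons are not ordered, and two such digraphs are equal iff their edges are.
FatherMap : ℕ → Set
FatherMap r = Vec (Maybe (Fin r)) r

module _ {r : ℕ} (T : FatherMap r) where

  father : Fin r → Maybe (Fin r)
  father = lookup T

  HasSon : Fin r → Fin r → Set
  HasSon v u = father u ≡ just v

  HasDescendant : Fin r → Fin r → Set
  HasDescendant = TransClosure HasSon

  _∈Hook_ : Fin r → Fin r → Set
  u ∈Hook v = u ≡ v ⊎ HasDescendant v u

  IsRootedTree : Set
  IsRootedTree = ∃ λ root → father root ≡ nothing × (∀ v → v ≢ root → HasDescendant root v)

  IsIncreasing : Set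
  IsIncreasing = ∀ v u → HasSon v u → label v < label u

  IsIncreasingTree : Set
  IsIncreasingTree = IsRootedTree × IsIncreasing

-- The transitive closure of a decidable relation on Fin n is decidable:
-- decide, for k = 0, …, n, the existence of a path whose inner vertices are all < k.
module _ {n : ℕ} {E : Fin n → Fin n → Set} (E? : ∀ v u → Dec (E v u)) where

  private
    data Path (k : ℕ) : Fin n → Fin n → Set where
      edge : ∀ {v u} → E v u → Path k v u
      step : ∀ {v w u} → E v w → toℕ w < k → Path k w u → Path k v u

    weaken : ∀ {k v u} → Path k v u → Path (suc k) v u
    weaken (edge e)     = edge e
    weaken (step e l p) = step e (ℕ.m<n⇒m<1+n l) (weaken p)

    Via : ℕ → Fin n → Fin n → Set
    Via k v u = ∃ λ m → toℕ m ≡ k × Path k v m × Path k m u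

    join : ∀ {k v m u} → toℕ m < k → Path k v m → Path k m u → Path k v u
    join l (edge e)      q = step e l q
    join l (step e l′ p) q = step e l′ (join l p q)

    build : ∀ {k v u} → Path k v u ⊎ Via k v u → Path (suc k) v u
    build (inj₁ p)                  = weaken p
    build (inj₂ (m , refl , p , q)) = join ℕ.≤-refl (weaken p) (weaken q)

    split : ∀ {k v u} → Path (suc k) v u → Path k v u ⊎ Via k v u
    split (edge e) = inj₁ (edge e)
    split {k} (step {w = w} e (s≤s l) p) with split p | toℕ w ℕ.≟ k
    ... | inj₁ p′                 | yes eq = inj₂ (w , eq , edge e , p′)
    ... | inj₁ p′                 | no neq = inj₁ (step e (ℕ.≤∧≢⇒< l neq) p′)
    ... | inj₂ (m , eq′ , p₁ , p₂) | yes eq = inj₂ (w , eq , edge e , subst (λ z → Path k z _) (Fin.toℕ-injective (trans eq′ (sym eq))) p₂)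
    ... | inj₂ (m , eq′ , p₁ , p₂) | no neq = inj₂ (m , eq′ , step e (ℕ.≤∧≢⇒< l neq) p₁ , p₂)

    path? : ∀ k v u → Dec (Path k v u)
    path? zero    v u = map′ edge (λ { (edge e) → e ; (step _ () _) }) (E? v u)
    path? (suc k) v u = map′ build split
      (path? k v u ⊎-dec Fin.any? (λ m → (toℕ m ℕ.≟ k) ×-dec (path? k v m ×-dec path? k m u)))

    to : ∀ {k v u} → Path k v u → TransClosure E v u
    to (edge e)     = [ e ]
    to (step e _ p) = e ∷ to p

    from : ∀ {v u} → TransClosure E v u → Path n v u
    from [ e ]   = edge e
    from (e ∷ p) = step e (Fin.toℕ<n _) (from p)

  transClosure? : ∀ v u → Dec (TransClosure E v u)
  transClosure? v u = map′ to from (path? n v u)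

module _ {r : ℕ} (T : FatherMap r) where

  hasSon? : ∀ v u → Dec (HasSon T v u)
  hasSon? v u = Maybe.≡-dec Fin._≟_ (father T u) (just v)

  hasDescendant? : ∀ v u → Dec (HasDescendant T v u)
  hasDescendant? = transClosure? hasSon?

  ∈Hook? : ∀ v u → Dec (_∈Hook_ T u v)
  ∈Hook? v u = (u Fin.≟ v) ⊎-dec hasDescendant? v u

  isRootedTree? : Dec (IsRootedTree T)
  isRootedTree? = Fin.any? λ root →
    Maybe.≡-dec Fin._≟_ (father T root) nothing
      ×-dec Fin.all? (λ v → ¬? (v Fin.≟ root) →-dec hasDescendant? root v)

  isIncreasing? : Dec (IsIncreasing T)
  isIncreasing? = Fin.all? λ v → Fin.all? λ u → hasSon? v u →-dec (label v ℕ.<? label u)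

  hook : Fin r → List (Fin r)
  hook v = filter (∈Hook? v) (allFin r)

isIncreasingTree? : ∀ {r} (T : FatherMap r) → Dec (IsIncreasingTree T)
isIncreasingTree? T = isRootedTree? T ×-dec isIncreasing? T

allVecs : ∀ {A : Set} → List A → (n : ℕ) → List (Vec A n)
allVecs xs zero    = Vec.[] ∷ []
allVecs xs (suc n) = cartesianProductWith Vec._∷_ xs (allVecs xs n)

allFatherMaps : (r : ℕ) → List (FatherMap r)
allFatherMaps r = allVecs (nothing ∷ map just (allFin r)) r

𝒰 : (r : ℕ) → List (FatherMap r)
𝒰 r = filter isIncreasingTree? (allFatherMaps r)

-- 𝒰 r lists every increasing tree on {1, …, r} exactly once.
private
  ∈-allVecs : ∀ {A : Set} {xs : List A} → (∀ a → a ∈ xs) → ∀ {n} (v : Vec A n) → v ∈ allVecs xs n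
  ∈-allVecs all Vec.[]        = here refl
  ∈-allVecs all (a Vec.∷ v) = ∈.∈-cartesianProductWith⁺ Vec._∷_ (all a) (∈-allVecs all v)

  allVecs-unique : ∀ {A : Set} {xs : List A} → Unique xs → ∀ n → Unique (allVecs xs n)
  allVecs-unique u zero    = All.[] ∷ []
  allVecs-unique u (suc n) = Unique.cartesianProductWith⁺ Vec._∷_ Vec.∷-injective u (allVecs-unique u n)

  ∈-entries : ∀ {r} (m : Maybe (Fin r)) → m ∈ (nothing ∷ map just (allFin r))
  ∈-entries nothing  = here refl
  ∈-entries (just v) = there (∈.∈-map⁺ just (∈.∈-allFin v))

  entries-unique : ∀ r → Unique (nothing ∷ map just (allFin r))
  entries-unique r = All.map⁺ (All.universal (λ _ ()) (allFin r))
    ∷ Unique.map⁺ Maybe.just-injective (Unique.allFin⁺ r)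

𝒰-complete : ∀ {r} (T : FatherMap r) → T ∈ 𝒰 r ⇔ IsIncreasingTree T
𝒰-complete {r} T = mk⇔ (proj₂ ∘ ∈.∈-filter⁻ isIncreasingTree? {xs = allFatherMaps r})
                       (∈.∈-filter⁺ isIncreasingTree? (∈-allVecs ∈-entries T))

𝒰-unique : ∀ r → Unique (𝒰 r)
𝒰-unique r = Unique.filter⁺ isIncreasingTree? (allVecs-unique (entries-unique r) r)

hasFather : ∀ {r} (T : FatherMap r) → IsIncreasingTree T → ∀ v → 2 ≤ label v → ∃ λ w → father T v ≡ just w
hasFather {suc r} T ((root , _ , reach) , inc) (suc v) _ with father T (suc v) in eq | suc v Fin.≟ root
... | just w  | _        = w , refl
... | nothing | yes refl = ⊥-elim (noFather₁ (reach zero λ ()))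
  where
  noFather₁ : ∀ {u} → ¬ HasDescendant T u zero
  noFather₁ [ s ] with inc _ _ s
  ... | s≤s ()
  noFather₁ (_ ∷ d) = noFather₁ d
... | nothing | no neq   = ⊥-elim (noFather (reach (suc v) neq))
  where
  noFather : ∀ {u} → ¬ HasDescendant T u (suc v)
  noFather [ s ] with trans (sym eq) s
  ... | ()
  noFather (_ ∷ d) = noFather d
hasFather {suc r} T _ zero (s≤s ())

module FiniteSums {c ℓ} (R : CommutativeRing c ℓ) where
  open CommutativeRing R using (Carrier; _+_; _*_; 0#; 1#)

  ∑ : ∀ {a} {A : Set a} → List A → (A → Carrier) → Carrier
  ∑ is f = foldr (λ i s → f i + s) 0# is

  ∏ : ∀ {a} {A : Set a} → List A → (A → Carrier) → Carrier
  ∏ is f = foldr (λ i p → f i * p) 1# is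

module Weights {c ℓ} (R : CommutativeRing c ℓ)
  (x : ℕ → CommutativeRing.Carrier R) (y : ℕ → ℕ → CommutativeRing.Carrier R) where
  open CommutativeRing R using (Carrier; _*_; 0#)
  open FiniteSums R

  -- The value 0# at a missing father never enters the weight of an increasing
  -- tree, by hasFather.
  wt : ∀ {r} → FatherMap r → Carrier
  wt {r} T = ∏ (filter (λ v → 2 ≤? label v) (allFin r)) λ v →
    maybe′ (x ∘ label) 0# (father T v) * ∑ (hook T v) λ u → y (label v) (label u)

{-# OPTIONS --safe #-}

-- In an increasing tree on {1, …, n + 1} the vertex n + 1 is a leaf; let p be its
-- father.  Deleting it leaves an arbitrary increasing tree on {1, …, n}, and since
-- n + 1 lies in exactly the hooks of the non-largest vertices that contain p, the
-- weight loses the factor x_p y_{n+1,n+1} once y_{i,p} is replaced by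
-- y_{i,p} + y_{i,n+1} for all i.  By induction the sum of weights is therefore a sum
-- over p of products of the row factors
-- (x_1 + … + x_i) y_{i,i} + x_i (y_{i,i+1} + … + y_{i,n}).  Writing P_i for row
-- factor i, s_i = x_1 + … + x_i and z_i = y_{i,n+1}, the replacement changes P_i to
-- P_i if p < i, P_i + s_i z_i if p = i, and Q_i = P_i + x_i z_i if p > i.  The
-- sum over p telescopes: with the rows and the fathers cut off at k it equals
-- s_k Q_2 ⋯ Q_k, because s_{k-1} P_k + x_k (P_k + s_k z_k) = s_k Q_k.
-- Row n occurs for n vertices only as y_{n,n}, without s_n, and so the last step
-- yields Q_n instead of s_n Q_n.
module Submission where

open import Defs
open import Algebra.Bundles using (CommutativeRing; CommutativeMonoid)
open import Data.Nat using (ℕ; suc; _∸_; _≤_)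
open import Data.Empty using (⊥-elim)
open import Data.Fin as Fin using (Fin; zero; suc; toℕ; inject₁; fromℕ)
import Data.Fin.Properties as Fin
open import Data.Fin.Relation.Unary.Top using (view; ‵fromℕ; ‵inject₁)
open import Data.List using (List; []; _∷_; _++_; _∷ʳ_; map; foldr; filter; upTo; applyUpTo; allFin; tabulate; cartesianProductWith)
open import Data.List.Membership.Propositional using (_∈_)
import Data.List.Membership.Propositional.Properties as ∈
open import Data.List.Membership.Propositional.Properties.WithK using (unique∧set⇒bag)
import Data.List.Properties as List
open import Data.List.Relation.Binary.BagAndSetEquality using (∼bag⇒↭)
open import Data.List.Relation.Binary.Permutation.Propositional as ↭ using (_↭_)
open import Data.List.Relation.Unary.All as All using ()
open import Data.List.Relation.Unary.AllPairs using ([]; _∷_)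
open import Data.List.Relation.Unary.Any using (here; there)
open import Data.List.Relation.Unary.Unique.Propositional using (Unique)
import Data.List.Relation.Unary.Unique.Propositional.Properties as Unique
open import Data.Maybe as Maybe using (Maybe; just; nothing; maybe′)
import Data.Maybe.Properties as Maybe
open import Data.Nat as ℕ using (zero; _<_; s≤s; z≤n)
import Data.Nat.Properties as ℕ
open import Data.Product using (∃; ∃₂; _×_; _,_; proj₁; proj₂; uncurry)
open import Data.Sum as Sum using (_⊎_; inj₁; inj₂)
open import Data.Vec as Vec using (Vec; lookup)
import Data.Vec.Properties as Vec
open import Data.Vec.Relation.Binary.Pointwise.Extensional using (ext; Pointwise-≡⇒≡)
open import Function using (_∘_; id)
open import Function.Bundles using (_⇔_; mk⇔; Equivalence)
open import Relation.Binary.Construct.Closure.Transitive using ([_]; _∷_)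
open import Relation.Binary.PropositionalEquality as ≡ using (_≡_; _≢_; cong; subst)
open import Relation.Nullary using (¬_; Dec; yes; no)
import Relation.Binary.Reasoning.Setoid as SetoidReasoning
import Algebra.Properties.CommutativeSemigroup as CommutativeSemigroupProperties
import Algebra.Solver.Ring.NaturalCoefficients.Default as SemiringSolver

private
  variable
    n r : ℕ

-- Integer intervals, and splitting off the last entry of lists and vectors.

-- The bound includes the case `a ≡ suc b`, where `range a b` is empty; up to there the subtraction
-- does not truncate.
range-∷ʳ : ∀ {a b} → a ≤ suc b → range a (suc b) ≡ range a b ∷ʳ suc b
range-∷ʳ {a} {b} a≤1+b = begin
  map (a ℕ.+_) (upTo (suc (suc b) ∸ a))           ≡⟨ cong (map (a ℕ.+_) ∘ upTo) (ℕ.+-∸-assoc 1 a≤1+b) ⟩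
  map (a ℕ.+_) (upTo (suc k))                     ≡⟨ cong (map (a ℕ.+_)) (≡.sym (List.upTo-∷ʳ k)) ⟩
  map (a ℕ.+_) (upTo k ∷ʳ k)                      ≡⟨ List.map-++ (a ℕ.+_) (upTo k) (k ∷ []) ⟩
  range a b ∷ʳ (a ℕ.+ k)                          ≡⟨ cong (range a b ∷ʳ_) (ℕ.m+[n∸m]≡n a≤1+b) ⟩
  range a b ∷ʳ suc b                              ∎
  where
  open ≡.≡-Reasoning
  k = suc b ∸ a

∈-range⁻ : ∀ a b {i} → i ∈ range a b → a ≤ i × i ≤ b
∈-range⁻ a b i∈ with k , k∈ , ≡.refl ← ∈.∈-map⁻ (a ℕ.+_) i∈ =
  ℕ.m≤m+n a k , ℕ.≤-pred (ℕ.<-≤-trans (ℕ.+-monoʳ-< a k<) (ℕ.≤-reflexive (ℕ.m+[n∸m]≡n a≤1+b)))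
  where
  k< : k < suc b ∸ a
  k< = ∈.∈-upTo⁻ k∈
  a≤1+b : a ≤ suc b
  -- A member forces `suc b ∸ a` to be nonzero, so the truncated subtraction is exact.
  a≤1+b = ℕ.<⇒≤ (ℕ.m∸n≢0⇒n<m (λ eq → ℕ.n≮0 (subst (k <_) eq k<)))

∈-range⁺ : ∀ {a b i} → a ≤ i → i ≤ b → i ∈ range a b
∈-range⁺ {a} {b} {i} a≤i i≤b = subst (_∈ range a b) (ℕ.m+[n∸m]≡n a≤i)
  (∈.∈-map⁺ (a ℕ.+_) (∈.∈-upTo⁺ (ℕ.∸-monoˡ-< (s≤s i≤b) a≤i)))

range-unique : ∀ a b → Unique (range a b)
range-unique a b = Unique.map⁺ (ℕ.+-cancelˡ-≡ a _ _) (Unique.upTo⁺ (suc b ∸ a))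

tabulate-toℕ : ∀ {a} {A : Set a} (f : ℕ → A) n → tabulate {n = n} (f ∘ toℕ) ≡ applyUpTo f n
tabulate-toℕ f zero    = ≡.refl
tabulate-toℕ f (suc n) = cong (f 0 ∷_) (tabulate-toℕ (f ∘ suc) n)

map-label-allFin : ∀ n → map label (allFin n) ≡ range 1 n
map-label-allFin n = begin
  map label (allFin n)  ≡⟨ List.map-tabulate id label ⟩
  tabulate label        ≡⟨ tabulate-toℕ suc n ⟩
  applyUpTo suc n       ≡⟨ List.map-upTo suc n ⟨
  range 1 n             ∎
  where open ≡.≡-Reasoning

tabulate-∷ʳ : ∀ {a} {A : Set a} {n} (f : Fin (suc n) → A) → tabulate f ≡ tabulate (f ∘ inject₁) ∷ʳ f (fromℕ n)
tabulate-∷ʳ {n = zero}  f = ≡.refl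
tabulate-∷ʳ {n = suc n} f = cong (f zero ∷_) (tabulate-∷ʳ (f ∘ suc))

allFin-∷ʳ : ∀ n → allFin (suc n) ≡ map inject₁ (allFin n) ∷ʳ fromℕ n
allFin-∷ʳ n = ≡.trans (tabulate-∷ʳ id) (cong (_∷ʳ fromℕ n) (≡.sym (List.map-tabulate id inject₁)))

lookup-∷ʳ-inject₁ : ∀ {a} {A : Set a} (xs : Vec A n) z i → lookup (xs Vec.∷ʳ z) (inject₁ i) ≡ lookup xs i
lookup-∷ʳ-inject₁ (_ Vec.∷ _)  z zero    = ≡.refl
lookup-∷ʳ-inject₁ (_ Vec.∷ xs) z (suc i) = lookup-∷ʳ-inject₁ xs z i

lookup-∷ʳ-fromℕ : ∀ {a} {A : Set a} (xs : Vec A n) z → lookup (xs Vec.∷ʳ z) (fromℕ n) ≡ z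
lookup-∷ʳ-fromℕ Vec.[]        z = ≡.refl
lookup-∷ʳ-fromℕ (_ Vec.∷ xs) z = lookup-∷ʳ-fromℕ xs z

lookup-ext : ∀ {a} {A : Set a} {xs ys : Vec A n} → (∀ i → lookup xs i ≡ lookup ys i) → xs ≡ ys
lookup-ext eq = Pointwise-≡⇒≡ (ext eq)

-- Increasing trees are recursive trees

-- Unlike reachability from the root, this condition is local to each vertex, so it can be carried
-- to and from an extension one entry at a time.
IsRecursive : FatherMap r → Set
IsRecursive T = ∀ v → (toℕ v ≡ 0 × father T v ≡ nothing) ⊎ (∃ λ w → father T v ≡ just w × toℕ w < toℕ v)

increasing⇒recursive : (T : FatherMap r) → IsIncreasingTree T → IsRecursive T
increasing⇒recursive T tree zero with father T zero in eq
... | nothing = inj₁ (≡.refl , ≡.refl)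
... | just w with s≤s () ← proj₂ tree w zero eq
increasing⇒recursive T tree (suc v) with w , eq ← hasFather T tree (suc v) (s≤s (s≤s z≤n)) =
  inj₂ (w , eq , ℕ.≤-pred (proj₂ tree w (suc v) eq))

module _ (T : FatherMap r) where

  ∈Hook-son : ∀ {v w u} → _∈Hook_ T w v → HasSon T w u → HasDescendant T v u
  ∈Hook-son (inj₁ ≡.refl)  s = [ s ]
  ∈Hook-son (inj₂ [ e ])   s = e ∷ [ s ]
  ∈Hook-son (inj₂ (e ∷ d)) s = e ∷ ∈Hook-son (inj₂ d) s

  -- `TransClosure` exposes the first edge of a path; this exposes the last one, the edge that
  -- enters `u`.
  hasDescendant⇒∈Hook-son : ∀ {v u} → HasDescendant T v u → ∃ λ w → _∈Hook_ T w v × HasSon T w u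
  hasDescendant⇒∈Hook-son [ s ]   = _ , inj₁ ≡.refl , s
  hasDescendant⇒∈Hook-son (e ∷ d) with hasDescendant⇒∈Hook-son d
  ... | w , inj₁ ≡.refl , s = w , inj₂ [ e ] , s
  ... | w , inj₂ d′     , s = w , inj₂ (e ∷ d′) , s

-- Passing to the father strictly lowers `toℕ`, so every chain of fathers ends, and it can end only
-- at `zero`.
recursive⇒increasing : (T : FatherMap (suc r)) → IsRecursive T → IsIncreasingTree T
recursive⇒increasing T rec = (zero , root , reach) , increasing
  where
  root : father T zero ≡ nothing
  root with rec zero
  ... | inj₁ (_ , eq)    = eq
  ... | inj₂ (_ , _ , ())

  -- Passing to a father is not structural recursion; the bound `k` on `toℕ v` decreases instead.
  zero∈ : ∀ k v → toℕ v < k → _∈Hook_ T v zero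
  zero∈ (suc k) v (s≤s v≤k) with rec v
  ... | inj₁ (eq , _)      = inj₁ (Fin.toℕ-injective eq)
  ... | inj₂ (w , s , w<v) = inj₂ (∈Hook-son T (zero∈ k w (ℕ.<-≤-trans w<v v≤k)) s)

  reach : ∀ v → v ≢ zero → HasDescendant T zero v
  reach v v≢0 with zero∈ _ v ℕ.≤-refl
  ... | inj₁ v≡0 = ⊥-elim (v≢0 v≡0)
  ... | inj₂ d   = d

  increasing : IsIncreasing T
  increasing v u s with rec u
  ... | inj₁ (_ , eq) with () ← ≡.trans (≡.sym eq) s
  ... | inj₂ (w , eq , w<u) with ≡.refl ← ≡.trans (≡.sym eq) s = s≤s w<u

-- Attaching the largest vertex as a leaf

extend : FatherMap r → Fin r → FatherMap (suc r)
extend T p = Vec.map (Maybe.map inject₁) T Vec.∷ʳ just (inject₁ p)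

father-inject₁ : (T : FatherMap r) (p v : Fin r) → father (extend T p) (inject₁ v) ≡ Maybe.map inject₁ (father T v)
father-inject₁ T p v = ≡.trans (lookup-∷ʳ-inject₁ (Vec.map (Maybe.map inject₁) T) _ v) (Vec.lookup-map v (Maybe.map inject₁) T)

father-fromℕ : (T : FatherMap r) (p : Fin r) → father (extend T p) (fromℕ r) ≡ just (inject₁ p)
father-fromℕ T p = lookup-∷ʳ-fromℕ (Vec.map (Maybe.map inject₁) T) _

-- Ensures that no tree arises twice when the largest vertex is attached.
extend-injective : {S T : FatherMap r} {p q : Fin r} → extend S p ≡ extend T q → S ≡ T × p ≡ q
extend-injective {S = S} {T} {p} {q} eq =
  lookup-ext (λ v → Maybe.map-injective Fin.inject₁-injective
    (≡.trans (≡.sym (father-inject₁ S p v)) (≡.trans (cong (λ U → father U (inject₁ v)) eq) (father-inject₁ T q v)))) ,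
  Fin.inject₁-injective (Maybe.just-injective (Vec.∷ʳ-injectiveʳ (Vec.map _ S) (Vec.map _ T) eq))

module _ (T : FatherMap r) (p : Fin r) where

  extend-recursive : IsRecursive T → IsRecursive (extend T p)
  extend-recursive rec v with view v
  ... | ‵fromℕ = inj₂ (inject₁ p , father-fromℕ T p ,
        ≡.subst₂ _<_ (≡.sym (Fin.toℕ-inject₁ p)) (≡.sym (Fin.toℕ-fromℕ r)) (Fin.toℕ<n p))
  ... | ‵inject₁ u rewrite father-inject₁ T p u with rec u
  ...   | inj₁ (eq , f)      rewrite f = inj₁ (≡.trans (Fin.toℕ-inject₁ u) eq , ≡.refl)
  ...   | inj₂ (w , f , w<u) rewrite f =
          inj₂ (inject₁ w , ≡.refl , ≡.subst₂ _<_ (≡.sym (Fin.toℕ-inject₁ w)) (≡.sym (Fin.toℕ-inject₁ u)) w<u)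

  extend-recursive⁻ : IsRecursive (extend T p) → IsRecursive T
  extend-recursive⁻ rec v with rec (inject₁ v)
  ... | inj₁ (eq , f) = inj₁ (≡.trans (≡.sym (Fin.toℕ-inject₁ v)) eq ,
        Maybe.map-injective Fin.inject₁-injective (≡.trans (≡.sym (father-inject₁ T p v)) f))
  ... | inj₂ (w , f , w<v) with father T v | ≡.trans (≡.sym (father-inject₁ T p v)) f
  ...   | just w′ | ≡.refl =
          inj₂ (w′ , ≡.refl , ≡.subst₂ _<_ (Fin.toℕ-inject₁ w′) (Fin.toℕ-inject₁ v) w<v)

  hasSon-inject₁⁺ : ∀ {v u} → HasSon T v u → HasSon (extend T p) (inject₁ v) (inject₁ u)
  hasSon-inject₁⁺ {u = u} s = ≡.trans (father-inject₁ T p u) (cong (Maybe.map inject₁) s)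

  hasSon-inject₁⁻ : ∀ {v u} → HasSon (extend T p) (inject₁ v) (inject₁ u) → HasSon T v u
  hasSon-inject₁⁻ {u = u} s = Maybe.map-injective Fin.inject₁-injective (≡.trans (≡.sym (father-inject₁ T p u)) s)

  -- Every father occurring in `extend T p` is of the form `inject₁ w`.
  fromℕ-hasNoSon : ∀ {u} → ¬ HasSon (extend T p) (fromℕ r) u
  fromℕ-hasNoSon {u} s with view u
  ... | ‵fromℕ = Fin.fromℕ≢inject₁ (Maybe.just-injective (≡.trans (≡.sym s) (father-fromℕ T p)))
  ... | ‵inject₁ v with father T v | ≡.trans (≡.sym (father-inject₁ T p v)) s
  ...   | just w | eq = Fin.fromℕ≢inject₁ (≡.sym (Maybe.just-injective eq))

  fromℕ-hasNoDescendant : ∀ {u} → ¬ HasDescendant (extend T p) (fromℕ r) u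
  fromℕ-hasNoDescendant [ s ]   = fromℕ-hasNoSon s
  fromℕ-hasNoDescendant (s ∷ _) = fromℕ-hasNoSon s

  hasDescendant-inject₁⁺ : ∀ {v u} → HasDescendant T v u → HasDescendant (extend T p) (inject₁ v) (inject₁ u)
  hasDescendant-inject₁⁺ [ s ]   = [ hasSon-inject₁⁺ s ]
  hasDescendant-inject₁⁺ (s ∷ d) = hasSon-inject₁⁺ s ∷ hasDescendant-inject₁⁺ d

  -- A path between old vertices cannot pass through the new one, which is a leaf, so all its inner
  -- vertices are old.
  hasDescendant-inject₁⁻ : ∀ {v u} → HasDescendant (extend T p) (inject₁ v) (inject₁ u) → HasDescendant T v u
  hasDescendant-inject₁⁻ [ s ] = [ hasSon-inject₁⁻ s ]
  hasDescendant-inject₁⁻ (_∷_ {y = w} s d) with view w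
  ... | ‵fromℕ     = ⊥-elim (fromℕ-hasNoDescendant d)
  ... | ‵inject₁ _ = hasSon-inject₁⁻ s ∷ hasDescendant-inject₁⁻ d

  ∈Hook-inject₁ : ∀ {v u} → (_∈Hook_ (extend T p) (inject₁ u) (inject₁ v)) ⇔ (_∈Hook_ T u v)
  ∈Hook-inject₁ = mk⇔ (Sum.map Fin.inject₁-injective hasDescendant-inject₁⁻)
                      (Sum.map (cong inject₁) hasDescendant-inject₁⁺)

  -- The only edge into the new vertex comes from `p`, so every path to it is a possibly empty path
  -- to `p` followed by that edge.
  fromℕ-∈Hook : ∀ {v} → (_∈Hook_ (extend T p) (fromℕ r) (inject₁ v)) ⇔ (_∈Hook_ T p v)
  fromℕ-∈Hook {v} = mk⇔ to from
    where
    to : _∈Hook_ (extend T p) (fromℕ r) (inject₁ v) → _∈Hook_ T p v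
    to (inj₁ eq) = ⊥-elim (Fin.fromℕ≢inject₁ eq)
    to (inj₂ d) with w , w∈ , s ← hasDescendant⇒∈Hook-son (extend T p) d
      with ≡.refl ← Maybe.just-injective (≡.trans (≡.sym s) (father-fromℕ T p)) = Equivalence.to ∈Hook-inject₁ w∈

    from : _∈Hook_ T p v → _∈Hook_ (extend T p) (fromℕ r) (inject₁ v)
    from p∈ = inj₂ (∈Hook-son (extend T p) (Equivalence.from ∈Hook-inject₁ p∈) (father-fromℕ T p))

-- With at least two vertices the largest is not the root and so has a father. Fathers being smaller
-- than sons, it is nobody's father, and every entry of `S` lifts along `inject₁`.
recursive⇒extend : (S : FatherMap (suc (suc r))) → IsRecursive S → ∃₂ λ T p → S ≡ extend T p
recursive⇒extend {r} S rec = T , proj₁ top , lookup-ext agree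
  where
  <⇒inject₁ : (w : Fin (suc (suc r))) → toℕ w < suc r → ∃ λ w′ → w ≡ inject₁ w′
  <⇒inject₁ w w< with view w
  ... | ‵fromℕ      = ⊥-elim (ℕ.<-irrefl (Fin.toℕ-fromℕ (suc r)) w<)
  ... | ‵inject₁ w′ = w′ , ≡.refl

  top : ∃ λ p → father S (fromℕ (suc r)) ≡ just (inject₁ p)
  top with rec (fromℕ (suc r))
  ... | inj₂ (w , f , w<) with w′ , ≡.refl ← <⇒inject₁ w (ℕ.<-≤-trans w< (ℕ.≤-reflexive (Fin.toℕ-fromℕ (suc r)))) = w′ , f

  below : ∀ v → ∃ λ m → father S (inject₁ v) ≡ Maybe.map inject₁ m
  below v with rec (inject₁ v)
  ... | inj₁ (_ , f) = nothing , f
  ... | inj₂ (w , f , w<) with w′ , ≡.refl ← <⇒inject₁ w (ℕ.<-trans w< (ℕ.≤-<-trans (ℕ.≤-reflexive (Fin.toℕ-inject₁ v)) (Fin.toℕ<n v))) =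
    just w′ , f

  T : FatherMap (suc r)
  T = Vec.tabulate (proj₁ ∘ below)

  agree : ∀ v → father S v ≡ father (extend T (proj₁ top)) v
  agree v with view v
  ... | ‵fromℕ     = ≡.trans (proj₂ top) (≡.sym (father-fromℕ T _))
  ... | ‵inject₁ u = begin
    father S (inject₁ u)                  ≡⟨ proj₂ (below u) ⟩
    Maybe.map inject₁ (proj₁ (below u))   ≡⟨ cong (Maybe.map inject₁) (Vec.lookup∘tabulate (proj₁ ∘ below) u) ⟨
    Maybe.map inject₁ (father T u)        ≡⟨ father-inject₁ T _ u ⟨
    father (extend T _) (inject₁ u)       ∎
    where open ≡.≡-Reasoning

extend-increasing : (T : FatherMap (suc r)) (p : Fin (suc r)) → IsIncreasingTree T → IsIncreasingTree (extend T p)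
extend-increasing T p tree = recursive⇒increasing (extend T p) (extend-recursive T p (increasing⇒recursive T tree))

increasing⇒extend : (S : FatherMap (suc (suc r))) → IsIncreasingTree S →
                    ∃₂ λ T p → IsIncreasingTree T × S ≡ extend T p
increasing⇒extend S tree with rec ← increasing⇒recursive S tree
  with T , p , ≡.refl ← recursive⇒extend S rec = T , p , recursive⇒increasing T (extend-recursive⁻ T p rec) , ≡.refl

-- The trees with one more vertex, listed as extensions.

unique∧⊆∧⊇⇒↭ : ∀ {a} {A : Set a} {xs ys : List A} → Unique xs → Unique ys →
               (∀ {z} → z ∈ xs → z ∈ ys) → (∀ {z} → z ∈ ys → z ∈ xs) → xs ↭ ys
unique∧⊆∧⊇⇒↭ xs! ys! xs⊆ys ys⊆xs = ∼bag⇒↭ (unique∧set⇒bag xs! ys! (mk⇔ xs⊆ys ys⊆xs))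

module _ (r : ℕ) where

  extensions : List (FatherMap (suc (suc r)))
  extensions = cartesianProductWith extend (𝒰 (suc r)) (allFin (suc r))

  private
    ∈-extensions⁺ : ∀ {S} → (∃₂ λ T p → IsIncreasingTree T × S ≡ extend T p) → S ∈ extensions
    ∈-extensions⁺ (T , p , tree , ≡.refl) =
      ∈.∈-cartesianProductWith⁺ extend (Equivalence.from (𝒰-complete T) tree) (∈.∈-allFin p)

    ∈-extensions⁻ : ∀ {S} → (∃₂ λ T p → T ∈ 𝒰 (suc r) × p ∈ allFin (suc r) × S ≡ extend T p) → IsIncreasingTree S
    ∈-extensions⁻ (T , p , T∈ , _ , ≡.refl) = extend-increasing T p (Equivalence.to (𝒰-complete T) T∈)

  -- Both lists are free of repetitions and have the same members. A permutation suffices for sums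
  -- and spares following the order through `filter`.
  𝒰-↭-extensions : 𝒰 (suc (suc r)) ↭ extensions
  𝒰-↭-extensions = unique∧⊆∧⊇⇒↭ (𝒰-unique (suc (suc r)))
    (Unique.cartesianProductWith⁺ extend extend-injective (𝒰-unique (suc r)) (Unique.allFin⁺ (suc r)))
    (λ {S} S∈ → ∈-extensions⁺ (increasing⇒extend S (Equivalence.to (𝒰-complete S) S∈)))
    (λ {S} S∈ → Equivalence.from (𝒰-complete S)
      (∈-extensions⁻ (∈.∈-cartesianProductWith⁻ extend (𝒰 (suc r)) (allFin (suc r)) S∈)))

-- Iterated operations

module BigOp {c ℓ} (M : CommutativeMonoid c ℓ) where
  open CommutativeMonoid M
  open CommutativeSemigroupProperties commutativeSemigroup using (interchange; x∙yz≈y∙xz)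
  open SetoidReasoning setoid

  -- FiniteSums.∑ and FiniteSums.∏ are definitionally the instances of ⨁.
  ⨁ : ∀ {a} {A : Set a} → List A → (A → Carrier) → Carrier
  ⨁ xs f = foldr (λ i s → f i ∙ s) ε xs

  -- Moves the condition of a `filter` into the summand, where `when-cong` can exchange it for an
  -- equivalent one.
  when : ∀ {a} {P : Set a} → Dec P → Carrier → Carrier
  when (yes _) c = c
  when (no _)  c = ε

  when-yes : ∀ {a} {P : Set a} (P? : Dec P) → P → ∀ c → when P? c ≈ c
  when-yes (yes _) p c = refl
  when-yes (no ¬p) p c = ⊥-elim (¬p p)

  when-no : ∀ {a} {P : Set a} (P? : Dec P) → ¬ P → ∀ c → when P? c ≈ ε
  when-no (yes p) ¬p c = ⊥-elim (¬p p)
  when-no (no _)  ¬p c = refl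

  when-cong : ∀ {a b} {P : Set a} {Q : Set b} (P? : Dec P) (Q? : Dec Q) → P ⇔ Q →
              ∀ {c d} → c ≈ d → when P? c ≈ when Q? d
  when-cong (yes p) Q? P⇔Q {c} {d} c≈d = trans c≈d (sym (when-yes Q? (Equivalence.to P⇔Q p) d))
  when-cong (no ¬p) Q? P⇔Q {c} {d} c≈d = sym (when-no Q? (¬p ∘ Equivalence.from P⇔Q) d)

  module _ {a} {A : Set a} where

    ⨁-cong : ∀ xs {f g : A → Carrier} → (∀ {i} → i ∈ xs → f i ≈ g i) → ⨁ xs f ≈ ⨁ xs g
    ⨁-cong []       f≈g = refl
    ⨁-cong (_ ∷ xs) f≈g = ∙-cong (f≈g (here ≡.refl)) (⨁-cong xs (f≈g ∘ there))

    ⨁-++ : ∀ xs ys (f : A → Carrier) → ⨁ (xs ++ ys) f ≈ ⨁ xs f ∙ ⨁ ys f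
    ⨁-++ []       ys f = sym (identityˡ _)
    ⨁-++ (x ∷ xs) ys f = trans (∙-congˡ (⨁-++ xs ys f)) (sym (assoc _ _ _))

    ⨁-∷ʳ : ∀ xs z (f : A → Carrier) → ⨁ (xs ∷ʳ z) f ≈ ⨁ xs f ∙ f z
    ⨁-∷ʳ xs z f = trans (⨁-++ xs (z ∷ []) f) (∙-congˡ (identityʳ _))

    ⨁-map : ∀ {b} {B : Set b} (h : B → A) xs (f : A → Carrier) → ⨁ (map h xs) f ≈ ⨁ xs (f ∘ h)
    ⨁-map h []       f = refl
    ⨁-map h (x ∷ xs) f = ∙-congˡ (⨁-map h xs f)

    ⨁-∙ : ∀ xs (f g : A → Carrier) → ⨁ xs (λ i → f i ∙ g i) ≈ ⨁ xs f ∙ ⨁ xs g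
    ⨁-∙ []       f g = sym (identityˡ ε)
    ⨁-∙ (x ∷ xs) f g = trans (∙-congˡ (⨁-∙ xs f g)) (interchange _ _ _ _)

    ⨁-ε : ∀ xs {f : A → Carrier} → (∀ {i} → i ∈ xs → f i ≈ ε) → ⨁ xs f ≈ ε
    ⨁-ε []       f≈ε = refl
    ⨁-ε (x ∷ xs) f≈ε = trans (∙-cong (f≈ε (here ≡.refl)) (⨁-ε xs (f≈ε ∘ there))) (identityˡ ε)

    ⨁-single : ∀ {xs p} {f : A → Carrier} → Unique xs → p ∈ xs → (∀ {i} → i ≢ p → f i ≈ ε) → ⨁ xs f ≈ f p
    ⨁-single {x ∷ xs} (x∉xs ∷ _) (here ≡.refl) f≈ε =
      trans (∙-congˡ (⨁-ε xs (λ i∈ → f≈ε (All.lookup x∉xs i∈ ∘ ≡.sym)))) (identityʳ _)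
    ⨁-single {x ∷ xs} (x∉xs ∷ xs!) (there p∈) f≈ε =
      trans (∙-cong (f≈ε (All.lookup x∉xs p∈)) (⨁-single xs! p∈ f≈ε)) (identityˡ _)

    ⨁-↭ : ∀ {xs ys} (f : A → Carrier) → xs ↭ ys → ⨁ xs f ≈ ⨁ ys f
    ⨁-↭ f ↭.refl         = refl
    ⨁-↭ f (↭.prep x p)   = ∙-congˡ (⨁-↭ f p)
    ⨁-↭ f (↭.swap x y p) = trans (∙-congˡ (∙-congˡ (⨁-↭ f p))) (x∙yz≈y∙xz _ _ _)
    ⨁-↭ f (↭.trans p q)  = trans (⨁-↭ f p) (⨁-↭ f q)

    ⨁-filter : ∀ {p} {P : A → Set p} (P? : ∀ i → Dec (P i)) xs (f : A → Carrier) →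
               ⨁ (filter P? xs) f ≈ ⨁ xs (λ i → when (P? i) (f i))
    ⨁-filter P? []       f = refl
    ⨁-filter P? (x ∷ xs) f with P? x
    ... | yes _ = ∙-congˡ (⨁-filter P? xs f)
    ... | no _  = trans (⨁-filter P? xs f) (sym (identityˡ _))

    ⨁-cartesianProductWith : ∀ {b b′} {B : Set b} {B′ : Set b′} (h : B → B′ → A) xs ys (f : A → Carrier) →
                             ⨁ (cartesianProductWith h xs ys) f ≈ ⨁ xs (λ i → ⨁ ys (λ j → f (h i j)))
    ⨁-cartesianProductWith h []       ys f = refl
    ⨁-cartesianProductWith h (x ∷ xs) ys f = trans (⨁-++ (map (h x) ys) _ f)
      (∙-cong (⨁-map (h x) ys f) (⨁-cartesianProductWith h xs ys f))

  ⨁-comm : ∀ {a b} {A : Set a} {B : Set b} xs ys (f : A → B → Carrier) →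
           ⨁ xs (λ i → ⨁ ys (f i)) ≈ ⨁ ys (λ j → ⨁ xs (λ i → f i j))
  ⨁-comm []       ys f = sym (⨁-ε ys (λ _ → refl))
  ⨁-comm (x ∷ xs) ys f = trans (∙-congˡ (⨁-comm xs ys f)) (sym (⨁-∙ ys (f x) _))

  ⨁-range-∷ʳ : ∀ a b (f : ℕ → Carrier) → a ≤ suc b → ⨁ (range a (suc b)) f ≈ ⨁ (range a b) f ∙ f (suc b)
  ⨁-range-∷ʳ a b f a≤1+b = trans (reflexive (cong (λ xs → ⨁ xs f) (range-∷ʳ a≤1+b))) (⨁-∷ʳ (range a b) (suc b) f)

  -- Separates the new vertex `fromℕ n` from the old ones `inject₁ i`, as hooks and weights of
  -- extended trees require.
  ⨁-filter-allFin : ∀ {p} {P : Fin (suc n) → Set p} (P? : ∀ i → Dec (P i)) (f : Fin (suc n) → Carrier) →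
    ⨁ (filter P? (allFin (suc n))) f
      ≈ ⨁ (allFin n) (λ i → when (P? (inject₁ i)) (f (inject₁ i))) ∙ when (P? (fromℕ n)) (f (fromℕ n))
  ⨁-filter-allFin {n = n} P? f = begin
    ⨁ (filter P? (allFin (suc n))) f                ≈⟨ ⨁-filter P? (allFin (suc n)) f ⟩
    ⨁ (allFin (suc n)) g                            ≡⟨ cong (λ xs → ⨁ xs g) (allFin-∷ʳ n) ⟩
    ⨁ (map inject₁ (allFin n) ∷ʳ fromℕ n) g         ≈⟨ ⨁-∷ʳ (map inject₁ (allFin n)) (fromℕ n) g ⟩
    ⨁ (map inject₁ (allFin n)) g ∙ g (fromℕ n)      ≈⟨ ∙-congʳ (⨁-map inject₁ (allFin n) g) ⟩
    ⨁ (allFin n) (g ∘ inject₁) ∙ g (fromℕ n)        ∎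
    where g = λ i → when (P? i) (f i)

-- Sums and products in the ring.

module _ {c ℓ} (R : CommutativeRing c ℓ) where
  open CommutativeRing R
  open FiniteSums R
  open SetoidReasoning setoid
  open SemiringSolver commutativeSemiring using (solve; _:+_; _:*_; _:=_)
  open BigOp +-commutativeMonoid using (when; when-yes; when-no; when-cong) renaming
    ( ⨁-cong to ∑-cong; ⨁-map to ∑-map; ⨁-∙ to ∑-+; ⨁-ε to ∑-0; ⨁-single to ∑-single; ⨁-↭ to ∑-↭; ⨁-filter to ∑-filter
    ; ⨁-cartesianProductWith to ∑-cartesianProductWith; ⨁-comm to ∑-comm
    ; ⨁-range-∷ʳ to ∑-range-∷ʳ; ⨁-filter-allFin to ∑-filter-allFin)
  open BigOp *-commutativeMonoid using () renaming
    ( when to when*; when-yes to when*-yes; when-cong to when*-cong; ⨁-cong to ∏-cong; ⨁-filter to ∏-filter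
    ; ⨁-range-∷ʳ to ∏-range-∷ʳ; ⨁-filter-allFin to ∏-filter-allFin)

  ∑-*ˡ : ∀ {a} {A : Set a} k xs (f : A → Carrier) → ∑ xs (λ i → k * f i) ≈ k * ∑ xs f
  ∑-*ˡ k []       f = sym (zeroʳ k)
  ∑-*ˡ k (x ∷ xs) f = trans (+-congˡ (∑-*ˡ k xs f)) (sym (distribˡ k _ _))

  ∑-*ʳ : ∀ {a} {A : Set a} k xs (f : A → Carrier) → ∑ xs (λ i → f i * k) ≈ ∑ xs f * k
  ∑-*ʳ k []       f = sym (zeroˡ k)
  ∑-*ʳ k (x ∷ xs) f = trans (+-congˡ (∑-*ʳ k xs f)) (sym (distribʳ k _ _))

  -- The vertex n + 1, hanging from p, lies in exactly the hooks containing p;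
  -- deleting it amounts to adding y i (n + 1) to y i p.
  absorb : ℕ → ℕ → (ℕ → ℕ → Carrier) → ℕ → ℕ → Carrier
  absorb n p y i j = y i j + when (j ℕ.≟ p) (y i (suc n))

  -- The weight of an extended tree and the recurrence for the sum of weights.

  module _ (x : ℕ → Carrier) (y : ℕ → ℕ → Carrier) where
    open Weights R

    ∑-hook-inject₁ : (T : FatherMap n) (p v : Fin n) →
      ∑ (hook (extend T p) (inject₁ v)) (λ u → y (label (inject₁ v)) (label u))
        ≈ ∑ (hook T v) (λ u → absorb n (label p) y (label v) (label u))
    ∑-hook-inject₁ {n} T p v = begin
      ∑ (hook (extend T p) (inject₁ v)) (λ u → y (label (inject₁ v)) (label u))
        ≡⟨ cong (λ k → ∑ (hook (extend T p) (inject₁ v)) (λ u → y (suc k) (label u))) (Fin.toℕ-inject₁ v) ⟩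
      ∑ (hook (extend T p) (inject₁ v)) (λ u → y i (label u))
        ≈⟨ ∑-filter-allFin (∈Hook? (extend T p) (inject₁ v)) (λ u → y i (label u)) ⟩
      ∑ (allFin n) (λ u → when (∈Hook? (extend T p) (inject₁ v) (inject₁ u)) (y i (label (inject₁ u))))
        + when (∈Hook? (extend T p) (inject₁ v) (fromℕ n)) (y i (label (fromℕ n)))
        ≈⟨ +-cong
             (∑-cong (allFin n) (λ {u} _ → when-cong (∈Hook? (extend T p) (inject₁ v) (inject₁ u)) (∈Hook? T v u)
               (∈Hook-inject₁ T p) (reflexive (cong (y i ∘ suc) (Fin.toℕ-inject₁ u)))))
             (when-cong (∈Hook? (extend T p) (inject₁ v) (fromℕ n)) (∈Hook? T v p)
               (fromℕ-∈Hook T p) (reflexive (cong (y i ∘ suc) (Fin.toℕ-fromℕ n)))) ⟩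
      ∑ (allFin n) (λ u → when (∈Hook? T v u) (y i (label u))) + when (∈Hook? T v p) (y i (suc n))
        ≈⟨ +-cong (sym (∑-filter (∈Hook? T v) (allFin n) (λ u → y i (label u)))) (sym ∑-when) ⟩
      ∑ (hook T v) (λ u → y i (label u)) + ∑ (hook T v) (λ u → when (label u ℕ.≟ label p) (y i (suc n)))
        ≈⟨ ∑-+ (hook T v) _ _ ⟨
      ∑ (hook T v) (λ u → absorb n (label p) y i (label u))
        ∎
      where
      i = label v

      label-injective : ∀ {u} → label u ≡ label p → u ≡ p
      label-injective = Fin.toℕ-injective ∘ ℕ.suc-injective

      -- The term of the new leaf, present exactly when `p` is in the hook of `v`, is charged to the
      -- single summand `u ≡ p`.
      ∑-when : ∑ (hook T v) (λ u → when (label u ℕ.≟ label p) (y i (suc n))) ≈ when (∈Hook? T v p) (y i (suc n))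
      ∑-when with ∈Hook? T v p
      ... | yes p∈ = trans
        (∑-single {p = p} (Unique.filter⁺ (∈Hook? T v) (Unique.allFin⁺ n)) (∈.∈-filter⁺ (∈Hook? T v) (∈.∈-allFin p) p∈)
          (λ {u} u≢p → when-no (label u ℕ.≟ label p) (u≢p ∘ label-injective) _))
        (when-yes (label p ℕ.≟ label p) ≡.refl _)
      ... | no p∉ = ∑-0 (hook T v) (λ {u} u∈ → when-no (label u ℕ.≟ label p)
        (λ eq → p∉ (subst (λ w → _∈Hook_ T w v) (label-injective eq) (proj₂ (∈.∈-filter⁻ (∈Hook? T v) {xs = allFin n} u∈)))) _)

    ∑-hook-fromℕ : (T : FatherMap n) (p : Fin n) →
      ∑ (hook (extend T p) (fromℕ n)) (λ u → y (label (fromℕ n)) (label u)) ≈ y (suc n) (suc n)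
    ∑-hook-fromℕ {n} T p = begin
      ∑ (hook (extend T p) (fromℕ n)) (λ u → y (label (fromℕ n)) (label u))
        ≈⟨ ∑-filter-allFin (∈Hook? (extend T p) (fromℕ n)) _ ⟩
      ∑ (allFin n) (λ u → when (∈Hook? (extend T p) (fromℕ n) (inject₁ u)) (y (label (fromℕ n)) (label (inject₁ u))))
        + when (∈Hook? (extend T p) (fromℕ n) (fromℕ n)) (y (label (fromℕ n)) (label (fromℕ n)))
        ≈⟨ +-cong
             (∑-0 (allFin n) (λ {u} _ → when-no (∈Hook? (extend T p) (fromℕ n) (inject₁ u))
               (λ { (inj₁ eq) → Fin.fromℕ≢inject₁ (≡.sym eq) ; (inj₂ d) → fromℕ-hasNoDescendant T p d }) _))
             (when-yes (∈Hook? (extend T p) (fromℕ n) (fromℕ n)) (inj₁ ≡.refl) _) ⟩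
      0# + y (label (fromℕ n)) (label (fromℕ n))
        ≈⟨ +-identityˡ _ ⟩
      y (label (fromℕ n)) (label (fromℕ n))
        ≡⟨ cong (λ k → y (suc k) (suc k)) (Fin.toℕ-fromℕ n) ⟩
      y (suc n) (suc n)
        ∎

    wt-extend : (T : FatherMap (suc n)) (p : Fin (suc n)) →
      wt x y (extend T p) ≈ (x (label p) * y (suc (suc n)) (suc (suc n))) * wt x (absorb (suc n) (label p) y) T
    wt-extend {n} T p = begin
      wt x y (extend T p)
        ≈⟨ ∏-filter-allFin (λ v → 2 ℕ.≤? label v) factor ⟩
      ∏ (allFin (suc n)) (λ v → when* (2 ℕ.≤? label (inject₁ v)) (factor (inject₁ v)))
        * when* (2 ℕ.≤? label (fromℕ (suc n))) (factor (fromℕ (suc n)))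
        ≈⟨ *-cong
             (∏-cong (allFin (suc n)) (λ {v} _ → when*-cong (2 ℕ.≤? label (inject₁ v)) (2 ℕ.≤? label v)
               (mk⇔ (subst (λ k → 2 ≤ suc k) (Fin.toℕ-inject₁ v)) (subst (λ k → 2 ≤ suc k) (≡.sym (Fin.toℕ-inject₁ v))))
               (*-cong (x-father v) (∑-hook-inject₁ T p v))))
             (trans (when*-yes (2 ℕ.≤? label (fromℕ (suc n))) (s≤s (s≤s z≤n)) _)
               (*-cong x-father-fromℕ (∑-hook-fromℕ T p))) ⟩
      ∏ (allFin (suc n)) (λ v → when* (2 ℕ.≤? label v) (factor′ v)) * (x (label p) * y (suc (suc n)) (suc (suc n)))
        ≈⟨ *-comm _ _ ⟩
      (x (label p) * y (suc (suc n)) (suc (suc n))) * ∏ (allFin (suc n)) (λ v → when* (2 ℕ.≤? label v) (factor′ v))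
        ≈⟨ *-congˡ (∏-filter (λ v → 2 ℕ.≤? label v) (allFin (suc n)) factor′) ⟨
      (x (label p) * y (suc (suc n)) (suc (suc n))) * wt x (absorb (suc n) (label p) y) T
        ∎
      where
      factor : Fin (suc (suc n)) → Carrier
      factor v = maybe′ (x ∘ label) 0# (father (extend T p) v) * ∑ (hook (extend T p) v) (λ u → y (label v) (label u))

      factor′ : Fin (suc n) → Carrier
      factor′ v = maybe′ (x ∘ label) 0# (father T v) * ∑ (hook T v) (λ u → absorb (suc n) (label p) y (label v) (label u))

      x-father : ∀ v → maybe′ (x ∘ label) 0# (father (extend T p) (inject₁ v)) ≈ maybe′ (x ∘ label) 0# (father T v)
      x-father v rewrite father-inject₁ T p v with father T v
      ... | nothing = refl
      ... | just w  = reflexive (cong (x ∘ suc) (Fin.toℕ-inject₁ w))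

      x-father-fromℕ : maybe′ (x ∘ label) 0# (father (extend T p) (fromℕ (suc n))) ≈ x (label p)
      x-father-fromℕ rewrite father-fromℕ T p = reflexive (cong (x ∘ suc) (Fin.toℕ-inject₁ p))

    -- The inner sum has the original form with one vertex less but with a modified `y`; an
    -- induction on it must therefore keep `y` arbitrary.
    ∑-𝒰-suc : ∀ n → ∑ (𝒰 (suc (suc n))) (wt x y)
      ≈ ∑ (range 1 (suc n)) (λ p → (x p * y (suc (suc n)) (suc (suc n))) * ∑ (𝒰 (suc n)) (wt x (absorb (suc n) p y)))
    ∑-𝒰-suc n = begin
      ∑ (𝒰 (suc (suc n))) (wt x y)
        ≈⟨ ∑-↭ (wt x y) (𝒰-↭-extensions n) ⟩
      ∑ (cartesianProductWith extend (𝒰 (suc n)) (allFin (suc n))) (wt x y)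
        ≈⟨ ∑-cartesianProductWith extend (𝒰 (suc n)) (allFin (suc n)) (wt x y) ⟩
      ∑ (𝒰 (suc n)) (λ T → ∑ (allFin (suc n)) (λ p → wt x y (extend T p)))
        ≈⟨ ∑-comm (𝒰 (suc n)) (allFin (suc n)) (λ T p → wt x y (extend T p)) ⟩
      ∑ (allFin (suc n)) (λ p → ∑ (𝒰 (suc n)) (λ T → wt x y (extend T p)))
        ≈⟨ ∑-cong (allFin (suc n)) (λ {p} _ → trans
             (∑-cong (𝒰 (suc n)) (λ {T} _ → wt-extend T p))
             (∑-*ˡ _ (𝒰 (suc n)) (wt x (absorb (suc n) (label p) y)))) ⟩
      ∑ (allFin (suc n)) (summand ∘ label)
        ≈⟨ ∑-map label (allFin (suc n)) summand ⟨
      ∑ (map label (allFin (suc n))) summand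
        ≡⟨ cong (λ ps → ∑ ps summand) (map-label-allFin (suc n)) ⟩
      ∑ (range 1 (suc n)) summand
        ∎
      where
      summand : ℕ → Carrier
      summand p = (x p * y (suc (suc n)) (suc (suc n))) * ∑ (𝒰 (suc n)) (wt x (absorb (suc n) p y))

  -- Row factors under absorption, and the telescoping sum over fathers.

  module _ (x : ℕ → Carrier) where

    -- The upper end `r` is a parameter so that, for `i ≤ n`, both P_i (at `n`) and Q_i (at `suc n`)
    -- are instances.
    rowFactor : ℕ → (ℕ → ℕ → Carrier) → ℕ → Carrier
    rowFactor r y i = ∑ (range 1 i) (λ j → x j * y i i) + ∑ (range (suc i) r) (λ j → x i * y i j)

    rowFactor-suc : ∀ {i} y → i ≤ n → rowFactor (suc n) y i ≈ rowFactor n y i + x i * y i (suc n)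
    rowFactor-suc {n} {i} y i≤n = trans (+-congˡ (∑-range-∷ʳ (suc i) n (λ j → x i * y i j) (s≤s i≤n))) (sym (+-assoc _ _ _))

    module _ (y : ℕ → ℕ → Carrier) where

      absorb-≢ : ∀ {p i j} → j ≢ p → absorb n p y i j ≈ y i j
      absorb-≢ {p = p} {j = j} j≢p = trans (+-congˡ (when-no (j ℕ.≟ p) j≢p _)) (+-identityʳ _)

      absorb-≡ : ∀ {i j} → absorb n j y i j ≈ y i j + y i (suc n)
      absorb-≡ {j = j} = +-congˡ (when-yes (j ℕ.≟ j) ≡.refl _)

      ∑-absorb-∉ : ∀ {p i} xs → (∀ {j} → j ∈ xs → j ≢ p) →
        ∑ xs (λ j → x i * absorb n p y i j) ≈ ∑ xs (λ j → x i * y i j)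
      ∑-absorb-∉ xs p∉ = ∑-cong xs (λ j∈ → *-congˡ (absorb-≢ (p∉ j∈)))

      -- Row `i` reads `y` only in columns `j ≥ i`, and column `p` lies to their left.
      rowFactor-absorb-< : ∀ {p i} → p < i → rowFactor n (absorb n p y) i ≈ rowFactor n y i
      rowFactor-absorb-< {n = n} {p} {i} p<i = +-cong
        (∑-cong (range 1 i) (λ _ → *-congˡ (absorb-≢ (ℕ.>⇒≢ p<i))))
        (∑-absorb-∉ (range (suc i) n) (λ j∈ → ℕ.>⇒≢ (ℕ.<-trans p<i (proj₁ (∈-range⁻ (suc i) n j∈)))))

      -- The diagonal entry occurs once with each of x_1, ..., x_i, so the increment is multiplied
      -- by their sum.
      rowFactor-absorb-≡ : ∀ {i} → rowFactor n (absorb n i y) i ≈ rowFactor n y i + ∑ (range 1 i) x * y i (suc n)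
      rowFactor-absorb-≡ {n = n} {i} = begin
        rowFactor n (absorb n i y) i
          ≈⟨ +-cong
               (∑-cong (range 1 i) (λ _ → trans (*-congˡ absorb-≡) (distribˡ _ _ _)))
               (∑-absorb-∉ (range (suc i) n) (λ j∈ → ℕ.>⇒≢ (proj₁ (∈-range⁻ (suc i) n j∈)))) ⟩
        ∑ (range 1 i) (λ j → x j * y i i + x j * y i (suc n)) + ∑ (range (suc i) n) (λ j → x i * y i j)
          ≈⟨ +-congʳ (trans (∑-+ (range 1 i) _ _) (+-congˡ (∑-*ʳ _ (range 1 i) x))) ⟩
        (∑ (range 1 i) (λ j → x j * y i i) + ∑ (range 1 i) x * y i (suc n)) + ∑ (range (suc i) n) (λ j → x i * y i j)
          ≈⟨ solve 3 (λ a b c → (a :+ b) :+ c := (a :+ c) :+ b) refl _ _ _ ⟩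
        rowFactor n y i + ∑ (range 1 i) x * y i (suc n)
          ∎

      -- Column `p` is met exactly once, off the diagonal, where the coefficient is `x i`; `p ≤ n`
      -- keeps it within the row.
      rowFactor-absorb-> : ∀ {p i} → i < p → p ≤ n →
        rowFactor n (absorb n p y) i ≈ rowFactor n y i + x i * y i (suc n)
      rowFactor-absorb-> {n = n} {p} {i} i<p p≤n = begin
        rowFactor n (absorb n p y) i
          ≈⟨ +-cong
               (∑-cong (range 1 i) (λ _ → *-congˡ (absorb-≢ (ℕ.<⇒≢ i<p))))
               (trans (∑-*ˡ _ (range (suc i) n) _) (*-congˡ (∑-+ (range (suc i) n) _ _))) ⟩
        ∑ (range 1 i) (λ j → x j * y i i)
          + x i * (∑ (range (suc i) n) (y i) + ∑ (range (suc i) n) (λ j → when (j ℕ.≟ p) (y i (suc n))))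
          ≈⟨ +-congˡ (distribˡ _ _ _) ⟩
        ∑ (range 1 i) (λ j → x j * y i i)
          + (x i * ∑ (range (suc i) n) (y i) + x i * ∑ (range (suc i) n) (λ j → when (j ℕ.≟ p) (y i (suc n))))
          ≈⟨ +-congˡ (+-cong (sym (∑-*ˡ _ (range (suc i) n) (y i))) (*-congˡ (trans
               (∑-single (range-unique (suc i) n) (∈-range⁺ i<p p≤n) (λ {j} j≢p → when-no (j ℕ.≟ p) j≢p _))
               (when-yes (p ℕ.≟ p) ≡.refl _)))) ⟩
        ∑ (range 1 i) (λ j → x j * y i i) + (∑ (range (suc i) n) (λ j → x i * y i j) + x i * y i (suc n))
          ≈⟨ +-assoc _ _ _ ⟨
        rowFactor n y i + x i * y i (suc n)
          ∎

      ∏-absorb-> : ∀ {l} → suc l ≤ n →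
        ∏ (range 2 l) (rowFactor n (absorb n (suc l) y)) ≈ ∏ (range 2 l) (rowFactor (suc n) y)
      ∏-absorb-> {l = l} l<n = ∏-cong (range 2 l) (λ i∈ → let i<1+l = s≤s (proj₂ (∈-range⁻ 2 l i∈)) in
        trans (rowFactor-absorb-> i<1+l l<n) (sym (rowFactor-suc y (ℕ.<⇒≤ (ℕ.<-≤-trans i<1+l l<n)))))

      -- Induction on the cut-off: fathers below the last row leave that row alone, so it factors
      -- out and the hypothesis applies; the last father is treated separately.
      ∑-∏-absorb : ∀ k → suc k ≤ n →
        ∑ (range 1 (suc k)) (λ p → x p * ∏ (range 2 (suc k)) (rowFactor n (absorb n p y)))
          ≈ ∑ (range 1 (suc k)) x * ∏ (range 2 (suc k)) (rowFactor (suc n) y)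
      -- The only father is 1 and both products are empty.
      ∑-∏-absorb zero _ = trans (+-identityʳ _) (*-congʳ (sym (+-identityʳ _)))
      ∑-∏-absorb {n = n} (suc k) k+2≤n = begin
        ∑ (range 1 (suc l)) (λ p → x p * ∏ (range 2 (suc l)) (G p))
          ≈⟨ ∑-range-∷ʳ 1 l (λ p → x p * ∏ (range 2 (suc l)) (G p)) (s≤s z≤n) ⟩
        ∑ (range 1 l) (λ p → x p * ∏ (range 2 (suc l)) (G p)) + x (suc l) * ∏ (range 2 (suc l)) (G (suc l))
          ≈⟨ +-cong (∑-cong (range 1 l) lower) (*-congˡ top) ⟩
        ∑ (range 1 l) (λ p → (x p * ∏ (range 2 l) (G p)) * P) + x (suc l) * (Π * (P + ∑ (range 1 (suc l)) x * z))
          ≈⟨ +-cong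
               (trans (∑-*ʳ P (range 1 l) _) (*-congʳ (∑-∏-absorb k (ℕ.<⇒≤ k+2≤n))))
               (*-congˡ (*-congˡ (+-congˡ (*-congʳ (∑-range-∷ʳ 1 l x (s≤s z≤n)))))) ⟩
        (∑ (range 1 l) x * Π) * P + x (suc l) * (Π * (P + (∑ (range 1 l) x + x (suc l)) * z))
          -- After cancelling `Π` this is s P + t (P + (s + t) z) = (s + t) (P + t z), the
          -- telescoping identity.
          ≈⟨ solve 5 (λ s Π P t z → (s :* Π) :* P :+ t :* (Π :* (P :+ (s :+ t) :* z)) := (s :+ t) :* (Π :* (P :+ t :* z)))
               refl _ Π P (x (suc l)) z ⟩
        (∑ (range 1 l) x + x (suc l)) * (Π * (P + x (suc l) * z))
          ≈⟨ *-cong (∑-range-∷ʳ 1 l x (s≤s z≤n)) (trans (∏-range-∷ʳ 2 l (rowFactor (suc n) y) (s≤s (s≤s z≤n))) (*-congˡ (rowFactor-suc y k+2≤n))) ⟨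
        ∑ (range 1 (suc l)) x * ∏ (range 2 (suc l)) (rowFactor (suc n) y)
          ∎
        where
        l = suc k
        G = λ p → rowFactor n (absorb n p y)
        Π = ∏ (range 2 l) (rowFactor (suc n) y)
        P = rowFactor n y (suc l)
        z = y (suc l) (suc n)

        lower : ∀ {p} → p ∈ range 1 l → x p * ∏ (range 2 (suc l)) (G p) ≈ (x p * ∏ (range 2 l) (G p)) * P
        lower {p} p∈ = trans
          (*-congˡ (trans (∏-range-∷ʳ 2 l (G p) (s≤s (s≤s z≤n))) (*-congˡ (rowFactor-absorb-< (s≤s (proj₂ (∈-range⁻ 1 l p∈)))))))
          (sym (*-assoc _ _ _))

        top : ∏ (range 2 (suc l)) (G (suc l)) ≈ Π * (P + ∑ (range 1 (suc l)) x * z)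
        top = trans (∏-range-∷ʳ 2 l (G (suc l)) (s≤s (s≤s z≤n)))
          (*-cong (∏-absorb-> k+2≤n) rowFactor-absorb-≡)

    -- Solving the recurrence.

    module _ (W : ℕ → (ℕ → ℕ → Carrier) → Carrier) (W-1 : ∀ y → W 1 y ≈ 1#)
      (W-suc : ∀ n y → W (suc (suc n)) y
        ≈ ∑ (range 1 (suc n)) (λ p → (x p * y (suc (suc n)) (suc (suc n))) * W (suc n) (absorb (suc n) p y)))
      where

      recurrence⇒product : ∀ m y → W (suc (suc m)) y
        ≈ (x 1 * y (suc (suc m)) (suc (suc m))) * ∏ (range 2 (suc m)) (rowFactor (suc (suc m)) y)
      -- Two vertices: the only father is 1, and the product over rows 2 to 1 is empty.
      recurrence⇒product zero y = begin
        W 2 y                                         ≈⟨ W-suc 0 y ⟩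
        (x 1 * y 2 2) * W 1 (absorb 1 1 y) + 0#       ≈⟨ +-identityʳ _ ⟩
        (x 1 * y 2 2) * W 1 (absorb 1 1 y)            ≈⟨ *-congˡ (W-1 (absorb 1 1 y)) ⟩
        (x 1 * y 2 2) * 1#                            ∎
      recurrence⇒product (suc k) y = begin
        W (suc q) y
          ≈⟨ W-suc l y ⟩
        ∑ (range 1 q) (λ p → (x p * Y) * W q (absorb q p y))
          ≈⟨ ∑-cong (range 1 q) (λ {p} _ → *-congˡ (recurrence⇒product k (absorb q p y))) ⟩
        ∑ (range 1 q) (λ p → (x p * Y) * ((x 1 * absorb q p y q q) * ∏ (range 2 l) (G p)))
          ≈⟨ ∑-range-∷ʳ 1 l (λ p → (x p * Y) * ((x 1 * absorb q p y q q) * ∏ (range 2 l) (G p))) (s≤s z≤n) ⟩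
        ∑ (range 1 l) (λ p → (x p * Y) * ((x 1 * absorb q p y q q) * ∏ (range 2 l) (G p)))
          + (x q * Y) * ((x 1 * absorb q q y q q) * ∏ (range 2 l) (G q))
          -- The corner entry stays `w` for fathers `p < q` and becomes `w + z` for `p ≡ q`, where
          -- moreover all rows up to `l` turn into those of `suc q`.
          ≈⟨ +-cong
               (∑-cong (range 1 l) lower)
               (*-congˡ (*-cong (*-congˡ (+-congˡ (when-yes (q ℕ.≟ q) ≡.refl z))) (∏-absorb-> y (ℕ.≤-refl {q})))) ⟩
        ∑ (range 1 l) (λ p → (x p * ∏ (range 2 l) (G p)) * ((x 1 * Y) * w)) + (x q * Y) * ((x 1 * (w + z)) * Π)
          ≈⟨ +-congʳ (trans (∑-*ʳ _ (range 1 l) _) (*-congʳ (∑-∏-absorb y k (ℕ.n≤1+n l)))) ⟩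
        (∑ (range 1 l) x * Π) * ((x 1 * Y) * w) + (x q * Y) * ((x 1 * (w + z)) * Π)
          -- The common factors leave s w + t (w + z) = (s + t) w + t z, which is row factor `q` for
          -- `suc q` vertices.
          ≈⟨ solve 7 (λ s Π x₁ Y w t z → (s :* Π) :* ((x₁ :* Y) :* w) :+ (t :* Y) :* ((x₁ :* (w :+ z)) :* Π)
                                       := (x₁ :* Y) :* (Π :* ((s :+ t) :* w :+ t :* z)))
               refl _ Π (x 1) Y w (x q) z ⟩
        (x 1 * Y) * (Π * ((∑ (range 1 l) x + x q) * w + x q * z))
          ≈⟨ *-congˡ (trans (∏-range-∷ʳ 2 l (rowFactor (suc q) y) (s≤s (s≤s z≤n))) (*-congˡ diagonal)) ⟨
        (x 1 * Y) * ∏ (range 2 q) (rowFactor (suc q) y)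
          ∎
        where
        l = suc k
        q = suc l
        Y = y (suc q) (suc q)
        w = y q q
        z = y q (suc q)
        G = λ p → rowFactor q (absorb q p y)
        Π = ∏ (range 2 l) (rowFactor (suc q) y)

        lower : ∀ {p} → p ∈ range 1 l → (x p * Y) * ((x 1 * absorb q p y q q) * ∏ (range 2 l) (G p))
                                        ≈ (x p * ∏ (range 2 l) (G p)) * ((x 1 * Y) * w)
        lower {p} p∈ = trans
          (*-congˡ (*-congʳ (*-congˡ (absorb-≢ y (ℕ.>⇒≢ (s≤s (proj₂ (∈-range⁻ 1 l p∈))))))))
          (solve 5 (λ t Y x₁ w π → (t :* Y) :* ((x₁ :* w) :* π) := (t :* π) :* ((x₁ :* Y) :* w)) refl _ Y (x 1) w _)

        diagonal : rowFactor (suc q) y q ≈ (∑ (range 1 l) x + x q) * w + x q * z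
        diagonal = begin
          rowFactor (suc q) y q
            ≈⟨ rowFactor-suc y ℕ.≤-refl ⟩
          (∑ (range 1 q) (λ j → x j * w) + ∑ (range (suc q) q) (λ j → x q * y q j)) + x q * z
            -- The interval from `suc q` to `q` is empty, but its length does not compute for a
            -- variable `k`; a member is refuted instead.
            ≈⟨ +-congʳ (+-cong (∑-*ʳ w (range 1 q) x)
                 (∑-0 (range (suc q) q) (λ j∈ → ⊥-elim (ℕ.<-irrefl ≡.refl (uncurry ℕ.<-≤-trans (∈-range⁻ (suc q) q j∈)))))) ⟩
          (∑ (range 1 q) x * w + 0#) + x q * z
            ≈⟨ +-congʳ (trans (+-identityʳ _) (*-congʳ (∑-range-∷ʳ 1 l x (s≤s z≤n)))) ⟩
          (∑ (range 1 l) x + x q) * w + x q * z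
            ∎

theorem1p1 : ∀ {c ℓ} (R : CommutativeRing c ℓ) →
  let open CommutativeRing R
      open FiniteSums R
      open Weights R
  in (r : ℕ) → 2 ≤ r → (x : ℕ → Carrier) (y : ℕ → ℕ → Carrier) →
     ∑ (𝒰 r) (wt x y)
       ≈ (x 1 * y r r) *
         ∏ (range 2 (r ∸ 1)) (λ i → ∑ (range 1 i) (λ j → x j * y i i) + ∑ (range (suc i) r) (λ j → x i * y i j))
theorem1p1 R (suc (suc m)) (s≤s (s≤s z≤n)) x y =
  recurrence⇒product R x (λ r y → FiniteSums.∑ R (𝒰 r) (Weights.wt R x y))
    -- `𝒰 1` evaluates to the one-vertex tree, whose weight is an empty product, so the initial
    -- value reads `1# + 0#`.
    (λ _ → CommutativeRing.+-identityʳ R _) (λ n y → ∑-𝒰-suc R x y n) m y
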